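{- Let $k$ be a positive integer. Let $G=(V,E,\partial)$ be a finite undirected graph with $V$ the disjoint union of $\{v_1,v_2,v_3,v_4\}$ (four distinct vertices) and a (possibly empty) set $Y$. Let $y_1,\ldots,y_m$ be all the vertices of $Y$ having odd degree in $G$ ($m=0$ if there are none). Suppose that after the deletion of any $k-1$ or fewer edges from $G$ there still exists a chain of edges $p$ with $\partial(p)=v_1+v_2+v_3+v_4$. Let $GN$ be any graph obtained from $G$ by adding new edges $\epsilon_1,\ldots,\epsilon_n$ such that each $\partial(\epsilon_i)$ is a sum of two different vertices, one from $\{y_1,\ldots,y_m\}$ and the other from $\{v_1,v_2,v_3,v_4,y_1,\ldots,y_m\}$, and such that each of $y_1,\ldots,y_m$ lies in the boundary of exactly one of the new edges ($n=0$ and $GN=G$ if $m=0$). Then in $GN$ there exist $k$ chains of edges $p_1,\ldots,p_k$, no two of which have a common nontrivial summand, such that $\partial(p_1)=\cdots=\partial(p_k)=v_1+v_2+v_3+v_4$ in $GN$.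
   Context: A graph $G=(V,E,\partial)$ consists of a finite nonempty vertex set $V$, a finite edge set $E$, and a map $\partial$ assigning to each edge a set of exactly two distinct vertices (parallel edges allowed, no loops); we write $\partial(e)=a+b$ for $\partial(e)=\{a,b\}$. The degree of a vertex $v$ is the number of edges $e$ with $v\in\partial(e)$. $A(S)$ is the $\mathbb{F}_2$-vector space of formal $\mathbb{F}_2$-linear combinations of elements of $S$; elements of $A(E)$ are chains of edges, with summands the edges of coefficient $1$. Two chains have no common nontrivial summand if no edge is a summand of both. $\partial$ extends $\mathbb{F}_2$-linearly to $A(E)\to A(V)$. Deleting edges means removing them from $E$ (the vertex set is unchanged). -}

module Defs where

open import Data.Nat using (ℕ; zero; suc; _+_; _%_)
open import Data.Bool using (Bool; true; false; _∧_; _∨_; _xor_; if_then_else_)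
open import Data.Fin using (Fin; splitAt; _≟_)
open import Data.Product using (_×_; _,_; proj₁; proj₂; ∃)
open import Data.Sum using (_⊎_; [_,_])
open import Relation.Nullary using (¬_)
open import Relation.Nullary.Decidable using (⌊_⌋)
open import Relation.Binary.PropositionalEquality using (_≡_; _≢_)
open import Function using (_∘_)

-- A graph with vertex set Fin nV and edge set Fin nE; each edge e has
-- boundary ∂(e) = a + b where ends e = (a , b) and a ≢ b (no loops,
-- parallel edges allowed).
record Graph : Set where
  field
    nV    : ℕ
    nE    : ℕ
    ends  : Fin nE → Fin nV × Fin nV
    noLoop : ∀ e → proj₁ (ends e) ≢ proj₂ (ends e)
open Graph public

-- Chains of edges / vertices: elements of A(S) over 𝔽₂, i.e. the
-- coefficient function S → Bool (true = coefficient 1).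
Chain : ℕ → Set
Chain m = Fin m → Bool

incident : ∀ {nV} → Fin nV → Fin nV × Fin nV → Bool
incident v (a , b) = ⌊ v ≟ a ⌋ ∨ ⌊ v ≟ b ⌋

xorSum : ∀ m → (Fin m → Bool) → Bool
xorSum zero    f = false
xorSum (suc m) f = f Data.Fin.zero xor xorSum m (f ∘ Data.Fin.suc)

countTrue : ∀ m → (Fin m → Bool) → ℕ
countTrue zero    f = 0
countTrue (suc m) f = (if f Data.Fin.zero then 1 else 0) + countTrue m (f ∘ Data.Fin.suc)

-- 𝔽₂-linear extension of ∂ : A(E) → A(V), for an edge set Fin m with
-- the given end-assignment: coefficient of v in ∂(p) is the parity of
-- the number of summands of p incident to v.
bd : ∀ {nV m} → (Fin m → Fin nV × Fin nV) → Chain m → Chain nV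
bd {m = m} ends p v = xorSum m (λ e → p e ∧ incident v (ends e))

degree : (G : Graph) → Fin (nV G) → ℕ
degree G v = countTrue (nE G) (λ e → incident v (ends G e))

sum4 : ∀ {nV} → Fin nV → Fin nV → Fin nV → Fin nV → Chain nV
sum4 v₁ v₂ v₃ v₄ v = ⌊ v ≟ v₁ ⌋ ∨ ⌊ v ≟ v₂ ⌋ ∨ ⌊ v ≟ v₃ ⌋ ∨ ⌊ v ≟ v₄ ⌋

_≐_ : ∀ {n} → Chain n → Chain n → Set
c ≐ d = ∀ v → c v ≡ d v

extendEnds : (G : Graph) (n : ℕ) → (Fin n → Fin (nV G) × Fin (nV G))
           → Fin (nE G + n) → Fin (nV G) × Fin (nV G)
extendEnds G n ε = [ ends G , ε ] ∘ splitAt (nE G)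

NoCommonSummand : ∀ {m} → Chain m → Chain m → Set
NoCommonSummand p q = ∀ e → p e ∧ q e ≡ false

-- A chain with boundary v₁ + v₂ + v₃ + v₄ meets every cut that isolates one vᵢ from the other three,
-- so by hypothesis all these cuts have at least k edges; and in GN all vertices of Y have even degree.
-- Both facts survive a suitable splitting-off at any y ∈ Y (replace y–u, y–w by u–w), as in the
-- Lovász–Cherkassky theorem, and the chains lift back. Once all edges join the vᵢ, perfect matchings
-- are removed greedily; when none is left, the remaining pairs form a star (a triangle would leave
-- some vᵢ isolated), whose spokes are removed three at a time.
module Submission where

open import Defs
open import Data.Nat using (ℕ; zero; suc; _<_; _≤_; _%_; _+_; z≤n; s≤s; s≤s⁻¹; _≤?_; _<?_; _≡ᵇ_)
open import Data.Nat.Properties using (+-assoc; ≤-refl; n≤1+n; ≤-trans; ≤-reflexive; ≰⇒>; ≮⇒≥; ≤-antisym; <-irrefl; <-≤-trans; m≤m+n; +-mono-≤; +-monoʳ-≤; +-mono-<-≤; +-cancelʳ-≤; +-commutativeSemigroup)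
open import Algebra.Properties.CommutativeSemigroup +-commutativeSemigroup using (interchange; x∙yz≈y∙xz)
open import Data.Bool using (Bool; true; false; not; _∧_; _∨_; _xor_; if_then_else_)
open import Data.Bool.Properties using (xor-assoc; xor-comm; xor-same; xor-identityʳ; not-distribˡ-xor; not-involutive; ∧-identityʳ; ¬-not; ∧-zeroʳ; ∧-idem; ∨-idem; ∨-zeroʳ; ∧-distribˡ-xor; not-¬) renaming (_≟_ to _≟ᵇ_)
open import Data.Fin using (Fin; zero; suc; _≟_; toℕ; splitAt)
open import Data.Fin.Patterns using (0F; 1F; 2F; 3F)
open import Data.Fin.Properties using (all?; toℕ<n; toℕ-injective; suc-injective) renaming (any? to anyFin?)
open import Data.Fin.Subset.Properties using (anySubset?)
open import Data.Vec using (lookup; tabulate; []; _∷_)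
open import Data.Vec.Properties using (lookup∘tabulate)
open import Data.List as List using (List; []; _∷_; _++_; length)
open import Data.List.Relation.Unary.All using (All; []; _∷_; universal) renaming (decide to All-decide; zip to All-zip; map to All-map)
open import Data.List.Relation.Unary.All.Properties using (¬Any⇒All¬; tabulate⁻)
open import Data.List.Relation.Unary.Any using (Any; here; there; any?)
open import Data.List.Relation.Binary.Permutation.Propositional using (_↭_; refl; prep; swap; trans; ↭-sym)
open import Data.List.Relation.Binary.Permutation.Propositional.Properties using (All-resp-↭; Any-resp-↭; ↭-length)
open import Data.Product.Properties using (≡-dec)
open import Data.Product using (_×_; _,_; Σ; proj₁; proj₂)
open import Data.Sum using (_⊎_; inj₁; inj₂; [_,_])
open import Data.Empty using (⊥; ⊥-elim)
open import Function using (_∘_)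
open import Relation.Nullary using (¬_; Dec; yes; no; contradiction)
open import Relation.Nullary.Decidable using (⌊_⌋; map′; from-yes; _×-dec_; _⊎-dec_; ¬?; _→-dec_)
open import Relation.Binary.PropositionalEquality as ≡ using (_≡_; _≢_; refl; sym; cong; cong₂; subst₂)

-- Only the cuts isolating a single vᵢ matter: across a cut with two of the vᵢ on each side a chain
-- has an even number of edges, possibly none. The obstacle to splitting y-u, y-w is an isolating
-- cut of size at most k+1 that both edges cross, for it would lose two edges. Parity tames these
-- cuts: as Y has only even degrees, all cuts isolating the same vᵢ have sizes of the same parity,
-- so an obstructing cut is a minimum one. Minimum cuts can be uncrossed, which is why some w always
-- works for a given y-u. Chains are tested against all cuts, not against single vertices. In this
-- form replacing two edges by their sum is linear, so both preserving parity and lifting chains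
-- back reduce to one identity about `cross`.

∀Bool? : {P : Bool → Set} → (∀ b → Dec (P b)) → Dec (∀ b → P b)
∀Bool? P? = map′ (λ { (p , q) true → p ; (p , q) false → q }) (λ f → f true , f false) (P? true ×-dec P? false)

xor-left-comm : ∀ a b c → a xor (b xor c) ≡ b xor (a xor c)
xor-left-comm = from-yes (∀Bool? λ a → ∀Bool? λ b → ∀Bool? λ c → a xor (b xor c) ≟ᵇ b xor (a xor c))

xor-interchange : ∀ a b c d → (a xor b) xor (c xor d) ≡ (a xor c) xor (b xor d)
xor-interchange = from-yes (∀Bool? λ a → ∀Bool? λ b → ∀Bool? λ c → ∀Bool? λ d →
  (a xor b) xor (c xor d) ≟ᵇ (a xor c) xor (b xor d))

-- Parity, edges and cuts of edge lists

ι : Bool → ℕ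
ι b = if b then 1 else 0

odd : ℕ → Bool
odd zero    = false
odd (suc n) = not (odd n)

Edge Cut : ℕ → Set
Edge N = Fin N × Fin N
Cut N = Fin N → Bool

single : ∀ {N} → Fin N → Cut N
single v x = ⌊ v ≟ x ⌋

single-refl : ∀ {N} (v : Fin N) → single v v ≡ true
single-refl v with v ≟ v
... | yes _  = refl
... | no v≢v = contradiction refl v≢v

single-≢ : ∀ {N} {v x : Fin N} → v ≢ x → single v x ≡ false
single-≢ {v = v} {x} v≢x with v ≟ x
... | yes v≡x = contradiction v≡x v≢x
... | no _    = refl

cross : ∀ {N} → Cut N → Edge N → Bool
cross X e = X (proj₁ e) xor X (proj₂ e)

-- Forgets the order in which the ends are stored, so that either end can be the vertex at which the
-- edge is split off.
Joins : ∀ {N} → Edge N → Fin N → Fin N → Set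
Joins e a b = ∀ X → cross X e ≡ X a xor X b

touching-joins : ∀ {N} (y : Fin N) (f : Edge N) → cross (single y) f ≡ true → Σ (Fin N) (Joins f y)
touching-joins y (a , b) touch with y ≟ a | y ≟ b
... | yes refl | no _     = b , λ X → refl
... | no _     | yes refl = a , λ X → xor-comm (X a) (X b)

cutSize : ∀ {N} → Cut N → List (Edge N) → ℕ
cutSize X []       = 0
cutSize X (e ∷ es) = ι (cross X e) + cutSize X es

cutParity : ∀ {N} → Cut N → List (Edge N) → Bool
cutParity X []       = false
cutParity X (e ∷ es) = cross X e xor cutParity X es

cutParity≡odd : ∀ {N} (X : Cut N) es → cutParity X es ≡ odd (cutSize X es)
cutParity≡odd X []       = refl
cutParity≡odd X (e ∷ es) with cross X e
... | true  = cong not (cutParity≡odd X es)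
... | false = cutParity≡odd X es

cutSize-cong : ∀ {N} {X Y : Cut N} → (∀ v → X v ≡ Y v) → ∀ es → cutSize X es ≡ cutSize Y es
cutSize-cong X≡Y []       = refl
cutSize-cong X≡Y (e ∷ es) = cong₂ (λ b n → ι b + n) (cong₂ _xor_ (X≡Y _) (X≡Y _)) (cutSize-cong X≡Y es)

cutSize-↭ : ∀ {N} (X : Cut N) {es es′} → es ↭ es′ → cutSize X es ≡ cutSize X es′
cutSize-↭ X refl         = refl
cutSize-↭ X (prep e p)   = cong (ι (cross X e) +_) (cutSize-↭ X p)
cutSize-↭ X (swap e f p) = ≡.trans (x∙yz≈y∙xz (ι (cross X e)) (ι (cross X f)) _)
  (cong (λ n → ι (cross X f) + (ι (cross X e) + n)) (cutSize-↭ X p))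
cutSize-↭ X (trans p q)  = ≡.trans (cutSize-↭ X p) (cutSize-↭ X q)

cutParity-↭ : ∀ {N} (X : Cut N) {es es′} → es ↭ es′ → cutParity X es ≡ cutParity X es′
cutParity-↭ X {es} {es′} p = ≡.trans (cutParity≡odd X es) (≡.trans (cong odd (cutSize-↭ X p)) (sym (cutParity≡odd X es′)))

extract : ∀ {A : Set} {P : A → Set} {xs} → Any P xs → Σ A λ x → Σ (List A) λ r → P x × xs ↭ x ∷ r
extract (here {x} {xs} px)   = x , xs , px , refl
extract (there {x} {xs} any) with extract any
... | z , r , pz , p = z , x ∷ r , pz , trans (prep x p) (swap x z refl)

crossing-edge : ∀ {N k} {P : Edge N → Set} (X : Cut N) {es} → All P es → suc k ≤ cutSize X es →
  Any (λ e → P e × cross X e ≡ true) es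
crossing-edge X (_∷_ {x = e} p ps) le with cross X e in eq
... | true  = here (p , eq)
... | false = there (crossing-edge X ps le)

-- If `n < m`, the bounds leave only `n = k` and `m = k + 1`, which differ in parity.
≤-by-parity : ∀ {k m n} → odd m ≡ odd n → m ≤ suc k → k ≤ n → m ≤ n
≤-by-parity {k} {m} {n} same m≤1+k k≤n with m ≤? n
... | yes m≤n = m≤n
... | no  m≰n with ≤-antisym (s≤s⁻¹ (≤-trans (≰⇒> m≰n) m≤1+k)) k≤n
...   | refl with ≤-antisym m≤1+k (≰⇒> m≰n)
...     | refl = contradiction (sym same) (not-¬ refl)

cutParity-uncrossed : ∀ {N} {X : Cut N} {es} → All (λ f → cross X f ≡ false) es → cutParity X es ≡ false
cutParity-uncrossed []       = refl
cutParity-uncrossed (p ∷ ps) = cong₂ _xor_ p (cutParity-uncrossed ps)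

flip : ∀ {N} → Fin N → Cut N → Cut N
flip y X v = X v xor single y v

cross-flip : ∀ {N} (y : Fin N) X f → cross (flip y X) f ≡ cross X f xor cross (single y) f
cross-flip y X (v , w) = xor-interchange (X v) (single y v) (X w) (single y w)

-- Moving `y` across changes the status of its own edges only; all of these cross `X`, so all of
-- them stop crossing.
cutSize-flip-≤ : ∀ {N} {y : Fin N} {X es} → All (λ f → cross (single y) f ≡ true → cross X f ≡ true) es →
  cutSize (flip y X) es ≤ cutSize X es
cutSize-flip-≤ []                       = z≤n
cutSize-flip-≤ {y = y} {X} {f ∷ es} (p ∷ ps) rewrite cross-flip y X f = +-mono-≤
  (from-yes (∀Bool? λ a → ∀Bool? λ b → ((b ≟ᵇ true) →-dec (a ≟ᵇ true)) →-dec (ι (a xor b) ≤? ι a))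
    (cross X f) (cross (single y) f) p)
  (cutSize-flip-≤ ps)

-- Uncrossing of cuts

PairLe : ∀ {N} (A B X Z : Cut N) → Set
PairLe A B X Z = ∀ f → ι (cross A f) + ι (cross B f) ≤ ι (cross X f) + ι (cross Z f)

cutSize-pair-≤ : ∀ {N} {A B X Z : Cut N} → PairLe A B X Z → ∀ es →
  cutSize A es + cutSize B es ≤ cutSize X es + cutSize Z es
cutSize-pair-≤ le []       = z≤n
cutSize-pair-≤ {A = A} {B} {X} {Z} le (e ∷ es) = subst₂ _≤_
  (interchange (ι (cross A e)) (ι (cross B e)) (cutSize A es) (cutSize B es))
  (interchange (ι (cross X e)) (ι (cross Z e)) (cutSize X es) (cutSize Z es))
  (+-mono-≤ (le e) (cutSize-pair-≤ le es))

_∩_ _∪_ _∖_ : ∀ {N} → Cut N → Cut N → Cut N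
(X ∩ Z) v = X v ∧ Z v
(X ∪ Z) v = X v ∨ Z v
(X ∖ Z) v = X v ∧ not (Z v)

-- Submodularity of the cut function, one edge at a time: a truth table over the sides of its two
-- ends.
∩∪-pair : ∀ {N} (X Z : Cut N) → PairLe (X ∩ Z) (X ∪ Z) X Z
∩∪-pair X Z (v , w) = from-yes (∀Bool? λ a → ∀Bool? λ b → ∀Bool? λ c → ∀Bool? λ d →
  ι ((a ∧ c) xor (b ∧ d)) + ι ((a ∨ c) xor (b ∨ d)) ≤? ι (a xor b) + ι (c xor d)) (X v) (X w) (Z v) (Z w)

-- Uncrossing retains the first set of the pair, so retaining the union calls for this order.
∪∩-pair : ∀ {N} (X Z : Cut N) → PairLe (X ∪ Z) (X ∩ Z) X Z
∪∩-pair X Z (v , w) = from-yes (∀Bool? λ a → ∀Bool? λ b → ∀Bool? λ c → ∀Bool? λ d →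
  ι ((a ∨ c) xor (b ∨ d)) + ι ((a ∧ c) xor (b ∧ d)) ≤? ι (a xor b) + ι (c xor d)) (X v) (X w) (Z v) (Z w)

-- Posimodularity: submodularity for `X` and the complement of `Z`. It serves cuts isolating
-- different terminals, since each difference keeps its own terminal.
∖∖-pair : ∀ {N} (X Z : Cut N) → PairLe (X ∖ Z) (Z ∖ X) X Z
∖∖-pair X Z (v , w) = from-yes (∀Bool? λ a → ∀Bool? λ b → ∀Bool? λ c → ∀Bool? λ d →
  ι ((a ∧ not c) xor (b ∧ not d)) + ι ((c ∧ not a) xor (d ∧ not b)) ≤? ι (a xor b) + ι (c xor d)) (X v) (X w) (Z v) (Z w)

module Terminals {N q : ℕ} (t : Fin q → Fin N) where

  record Isolates (i : Fin q) (X : Cut N) : Set where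
    constructor isolating
    field
      at-terminal : ∀ j → X (t j) ≡ ⌊ i ≟ j ⌋
  open Isolates

  isolates? : ∀ i X → Dec (Isolates i X)
  isolates? i X = map′ isolating at-terminal (all? λ j → X (t j) ≟ᵇ ⌊ i ≟ j ⌋)

  isolates-∩ : ∀ {i X Z} → Isolates i X → Isolates i Z → Isolates i (X ∩ Z)
  isolates-∩ (isolating IX) (isolating IZ) = isolating λ j →
    ≡.trans (cong₂ _∧_ (IX j) (IZ j)) (∧-idem _)

  isolates-∪ : ∀ {i X Z} → Isolates i X → Isolates i Z → Isolates i (X ∪ Z)
  isolates-∪ (isolating IX) (isolating IZ) = isolating λ j →
    ≡.trans (cong₂ _∨_ (IX j) (IZ j)) (∨-idem _)

  isolates-∖ : ∀ {i i′ X Z} → i ≢ i′ → Isolates i X → Isolates i′ Z → Isolates i (X ∖ Z)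
  isolates-∖ {i} {i′} {X} {Z} i≢i′ (isolating IX) (isolating IZ) = isolating at
    where
    at : ∀ j → X (t j) ∧ not (Z (t j)) ≡ ⌊ i ≟ j ⌋
    at j rewrite IX j | IZ j with i ≟ j | i′ ≟ j
    ... | yes refl | yes refl = contradiction refl i≢i′
    ... | yes _    | no _     = refl
    ... | no _     | _        = refl

  record MinCut (es : List (Edge N)) (i : Fin q) (X : Cut N) : Set where
    field
      isolates : Isolates i X
      minimal  : ∀ {Z} → Isolates i Z → cutSize X es ≤ cutSize Z es
  open MinCut

  -- Minimality of `Z` makes `B` at least as large as `Z`, so by the pair inequality `A` is at most
  -- as large as `X`.
  uncross : ∀ {es i j A B X Z} → PairLe A B X Z → Isolates i A → Isolates j B →
    MinCut es i X → MinCut es j Z → MinCut es i A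
  uncross {es} {A = A} {B} {X} {Z} le IA IB mX mZ = record
    { isolates = IA
    ; minimal  = λ IW → ≤-trans (+-cancelʳ-≤ (cutSize B es) _ _
        (≤-trans (cutSize-pair-≤ {A = A} {B} {X} {Z} le es) (+-monoʳ-≤ (cutSize X es) (minimal mZ IB)))) (minimal mX IW)
    }

  -- A strict gain on `e` alone would make `A` and `B` together smaller than two minimum cuts.
  uncross-strict : ∀ {e r y u i j A B X Z} → PairLe A B X Z → Isolates i A → Isolates j B →
    MinCut (e ∷ r) i X → MinCut (e ∷ r) j Z → Joins e y u →
    ¬ (ι (A y xor A u) + ι (B y xor B u) < ι (X y xor X u) + ι (Z y xor Z u))
  uncross-strict {e} {r} {A = A} {B} {X} {Z} le IA IB mX mZ J lt
    rewrite sym (J A) | sym (J B) | sym (J X) | sym (J Z) =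
    <-irrefl refl (<-≤-trans
      (subst₂ _<_
        (interchange (ι (cross A e)) (ι (cross B e)) (cutSize A r) (cutSize B r))
        (interchange (ι (cross X e)) (ι (cross Z e)) (cutSize X r) (cutSize Z r))
        (+-mono-<-≤ lt (cutSize-pair-≤ {A = A} {B} {X} {Z} le r)))
      (+-mono-≤ (minimal mX IA) (minimal mZ IB)))

  uncross-∩ : ∀ {es i X Z} → MinCut es i X → MinCut es i Z → MinCut es i (X ∩ Z)
  uncross-∩ {X = X} {Z} mX mZ = uncross (∩∪-pair X Z)
    (isolates-∩ (isolates mX) (isolates mZ)) (isolates-∪ (isolates mX) (isolates mZ)) mX mZ

  uncross-∪ : ∀ {es i X Z} → MinCut es i X → MinCut es i Z → MinCut es i (X ∪ Z)
  uncross-∪ {X = X} {Z} mX mZ = uncross (∪∩-pair X Z)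
    (isolates-∪ (isolates mX) (isolates mZ)) (isolates-∩ (isolates mX) (isolates mZ)) mX mZ

  uncross-∖ : ∀ {es i j X Z} → i ≢ j → MinCut es i X → MinCut es j Z → MinCut es i (X ∖ Z)
  uncross-∖ {X = X} {Z} i≢j mX mZ = uncross (∖∖-pair X Z)
    (isolates-∖ i≢j (isolates mX) (isolates mZ)) (isolates-∖ (i≢j ∘ sym) (isolates mZ) (isolates mX)) mX mZ

  record Blocker (es : List (Edge N)) (y u : Fin N) : Set where
    field
      index     : Fin q
      set       : Cut N
      minCut    : MinCut es index set
      separates : set y xor set u ≡ true
  open Blocker

  -- Minimum cuts separating the ends y, u of one edge merge into a single such cut: in every
  -- configuration where uncrossing does not produce it, the edge y–u would make uncrossing strict.
  merge : ∀ {e r y u} → Joins e y u → (P Q : Blocker (e ∷ r) y u) → Σ (Blocker (e ∷ r) y u) λ R →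
    ∀ w → (set P y xor set P w) ∨ (set Q y xor set Q w) ≡ true → set R y xor set R w ≡ true
  merge {e} {r} {y} {u} J P Q = go (minCut P) (minCut Q) (index P ≟ index Q) (X y) refl (Z y) refl
    where
    X Z : Cut N
    X = set P
    Z = set Q

    Covers : Cut N → Set
    Covers A = ∀ w → (X y xor X w) ∨ (Z y xor Z w) ≡ true → A y xor A w ≡ true

    Result : Set
    Result = Σ (Blocker (e ∷ r) y u) λ R → Covers (set R)

    build : ∀ {i A} → MinCut (e ∷ r) i A → Covers A → Result
    build m c = record { minCut = m ; separates = c u (cong (_∨ (Z y xor Z u)) (separates P)) } , c

    -- Otherwise `e` would run between the two differences, crossing both `X` and `Z` but neither
    -- their intersection nor their union.
    clash-same : ∀ {i} → MinCut (e ∷ r) i X → MinCut (e ∷ r) i Z → ¬ (X y xor Z y ≡ true)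
    clash-same mX mZ p = uncross-strict (∩∪-pair X Z)
      (isolates-∩ (isolates mX) (isolates mZ)) (isolates-∪ (isolates mX) (isolates mZ)) mX mZ J
      (from-yes (∀Bool? λ a → ∀Bool? λ b → ∀Bool? λ c → ∀Bool? λ d →
        (a xor c ≟ᵇ true) →-dec (a xor b ≟ᵇ true) →-dec (c xor d ≟ᵇ true) →-dec
        (ι ((a ∧ c) xor (b ∧ d)) + ι ((a ∨ c) xor (b ∨ d)) <? ι (a xor b) + ι (c xor d)))
        (X y) (X u) (Z y) (Z u) p (separates P) (separates Q))

    -- Otherwise `e` would run from the intersection to the outside of both sets, crossing `X` and
    -- `Z` but neither difference.
    clash-different : ∀ {i j} → i ≢ j → MinCut (e ∷ r) i X → MinCut (e ∷ r) j Z → ¬ (X y xor Z y ≡ false)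
    clash-different i≢j mX mZ p = uncross-strict (∖∖-pair X Z)
      (isolates-∖ i≢j (isolates mX) (isolates mZ)) (isolates-∖ (i≢j ∘ sym) (isolates mZ) (isolates mX)) mX mZ J
      (from-yes (∀Bool? λ a → ∀Bool? λ b → ∀Bool? λ c → ∀Bool? λ d →
        (a xor c ≟ᵇ false) →-dec (a xor b ≟ᵇ true) →-dec (c xor d ≟ᵇ true) →-dec
        (ι ((a ∧ not c) xor (b ∧ not d)) + ι ((c ∧ not a) xor (d ∧ not b)) <? ι (a xor b) + ι (c xor d)))
        (X y) (X u) (Z y) (Z u) p (separates P) (separates Q))

    go : ∀ {i j} → MinCut (e ∷ r) i X → MinCut (e ∷ r) j Z → Dec (i ≡ j) → ∀ p → X y ≡ p → ∀ q → Z y ≡ q → Result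
    go mX mZ (yes refl) false p false q = build (uncross-∪ mX mZ) λ w →
      from-yes (∀Bool? λ a → ∀Bool? λ b → ∀Bool? λ c → ∀Bool? λ d →
        (a ≟ᵇ false) →-dec (c ≟ᵇ false) →-dec ((a xor b) ∨ (c xor d) ≟ᵇ true) →-dec ((a ∨ c) xor (b ∨ d) ≟ᵇ true))
        (X y) (X w) (Z y) (Z w) p q
    go mX mZ (yes refl) true  p true  q = build (uncross-∩ mX mZ) λ w →
      from-yes (∀Bool? λ a → ∀Bool? λ b → ∀Bool? λ c → ∀Bool? λ d →
        (a ≟ᵇ true) →-dec (c ≟ᵇ true) →-dec ((a xor b) ∨ (c xor d) ≟ᵇ true) →-dec ((a ∧ c) xor (b ∧ d) ≟ᵇ true))
        (X y) (X w) (Z y) (Z w) p q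
    go mX mZ (no i≢j)   true  p false q = build (uncross-∖ i≢j mX mZ) λ w →
      from-yes (∀Bool? λ a → ∀Bool? λ b → ∀Bool? λ c → ∀Bool? λ d →
        (a ≟ᵇ true) →-dec (c ≟ᵇ false) →-dec ((a xor b) ∨ (c xor d) ≟ᵇ true) →-dec ((a ∧ not c) xor (b ∧ not d) ≟ᵇ true))
        (X y) (X w) (Z y) (Z w) p q
    go mX mZ (no i≢j)   false p true  q = build (uncross-∖ (i≢j ∘ sym) mZ mX) λ w →
      from-yes (∀Bool? λ a → ∀Bool? λ b → ∀Bool? λ c → ∀Bool? λ d →
        (a ≟ᵇ false) →-dec (c ≟ᵇ true) →-dec ((a xor b) ∨ (c xor d) ≟ᵇ true) →-dec ((c ∧ not a) xor (d ∧ not b) ≟ᵇ true))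
        (X y) (X w) (Z y) (Z w) p q
    go mX mZ (yes refl) true  p false q = ⊥-elim (clash-same mX mZ (cong₂ _xor_ p q))
    go mX mZ (yes refl) false p true  q = ⊥-elim (clash-same mX mZ (cong₂ _xor_ p q))
    go mX mZ (no i≢j)   true  p true  q = ⊥-elim (clash-different i≢j mX mZ (cong₂ _xor_ p q))
    go mX mZ (no i≢j)   false p false q = ⊥-elim (clash-different i≢j mX mZ (cong₂ _xor_ p q))

  merge-all : ∀ {e r y u} → Joins e y u → ∀ {l} →
    All (λ f → cross (single y) f ≡ true → Σ (Blocker (e ∷ r) y u) λ B → cross (set B) f ≡ true) l →
    All (λ f → cross (single y) f ≡ false) l ⊎
    Σ (Blocker (e ∷ r) y u) λ B → All (λ f → cross (single y) f ≡ true → cross (set B) f ≡ true) l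
  merge-all J [] = inj₁ []
  merge-all {y = y} J {f ∷ l} (p ∷ ps) with cross (single y) f in touch | merge-all J ps
  ... | false | inj₁ clear    = inj₁ (touch ∷ clear)
  ... | false | inj₂ (B , bs) = inj₂ (B , (λ touch′ → contradiction (≡.trans (sym touch) touch′) λ ()) ∷ bs)
  ... | true  | inj₁ clear with p refl
  ...   | B , b = inj₂ (B , (λ _ → b) ∷ All-map (λ clear′ touch′ → contradiction (≡.trans (sym clear′) touch′) λ ()) clear)
  merge-all {e} {r} {y} J {f ∷ l} (p ∷ ps) | true | inj₂ (B , bs) with p refl
  ... | C , c with merge J C B
  ...   | R , cover = inj₂ (R , (λ _ → covered f touch (cong (_∨ cross (set B) f) c))
                             ∷ All-map (λ {f′} b touch′ → covered f′ touch′ (≡.trans (cong (cross (set C) f′ ∨_) (b touch′)) (∨-zeroʳ _))) bs)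
    where
    covered : ∀ f → cross (single y) f ≡ true → cross (set C) f ∨ cross (set B) f ≡ true → cross (set R) f ≡ true
    covered f touch h with touching-joins y f touch
    ... | w , Jf rewrite Jf (set C) | Jf (set B) | Jf (set R) = cover w h

  -- Splitting off two edges

  -- The field `parity` expresses that all nonterminals have even degree: the parity of a cut is the
  -- sum of the degrees inside it, so only terminals influence it.
  record Invariant (k : ℕ) (es : List (Edge N)) : Set where
    field
      cuts-large : ∀ {i X} → Isolates i X → k ≤ cutSize X es
      parity     : ∀ {X Z} → (∀ j → X (t j) ≡ Z (t j)) → cutParity X es ≡ cutParity Z es
  open Invariant

  invariant-↭ : ∀ {k es es′} → es ↭ es′ → Invariant k es → Invariant k es′
  invariant-↭ p inv = record
    { cuts-large = λ I → ≤-trans (cuts-large inv I) (≤-reflexive (cutSize-↭ _ p))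
    ; parity     = λ {X} {Z} same → ≡.trans (sym (cutParity-↭ X p)) (≡.trans (parity inv same) (cutParity-↭ Z p))
    }

  -- Every competitor agrees with `X` on the terminals, hence has a size of the same parity, and
  -- that size is at least `k`.
  tight⇒minCut : ∀ {k es i X} → Invariant k es → Isolates i X → cutSize X es ≤ suc k → MinCut es i X
  tight⇒minCut {es = es} {X = X} inv I le = record
    { isolates = I
    ; minimal  = λ {Z} IZ → ≤-by-parity
        (≡.trans (sym (cutParity≡odd X es)) (≡.trans (parity inv λ j → ≡.trans (at-terminal I j) (sym (at-terminal IZ j))) (cutParity≡odd Z es)))
        le (cuts-large inv IZ)
    }

  -- A cut crossed by both edges loses two when they are split off, so it must start with at least
  -- `k + 2`.
  Safe : ℕ → List (Edge N) → Edge N → Edge N → Set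
  Safe k es e f = ∀ {i X} → Isolates i X → cross X e ≡ true → cross X f ≡ true → suc k < cutSize X es

  -- There are finitely many cuts, so an obstructing one can be searched for. The search runs over
  -- vectors, and a cut is compared with its table.
  safe-or-blocked : ∀ {k es} → Invariant k es → ∀ e f → Safe k es e f ⊎
    (Σ (Fin q) λ i → Σ (Cut N) λ X → MinCut es i X × cross X e ≡ true × cross X f ≡ true)
  safe-or-blocked {k} {es} inv e f with anyFin? (λ i → anySubset? (λ S → isolates? i (lookup S)
      ×-dec (cross (lookup S) e ≟ᵇ true) ×-dec (cross (lookup S) f ≟ᵇ true) ×-dec (cutSize (lookup S) es ≤? suc k)))
  ... | yes (i , S , I , ce , cf , le) = inj₂ (i , lookup S , tight⇒minCut inv I le , ce , cf)
  ... | no none = inj₁ λ {i} {X} I ce cf → ≰⇒> λ le →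
    let same = lookup∘tabulate X in
    none (i , tabulate X , isolating (λ j → ≡.trans (same (t j)) (at-terminal I j)) ,
      ≡.trans (cong₂ _xor_ (same _) (same _)) ce , ≡.trans (cong₂ _xor_ (same _) (same _)) cf ,
      ≤-trans (≤-reflexive (cutSize-cong same es)) le)

  -- If every other edge at y were blocked, a single minimum cut would cross all edges at y,
  -- and moving y to its other side would make it smaller.
  partner : ∀ {k e r y u} → Invariant k (e ∷ r) → Joins e y u → y ≢ u → (∀ j → t j ≢ y) →
    Σ (Edge N) λ f → Σ (List (Edge N)) λ r′ → (cross (single y) f ≡ true × Safe k (e ∷ r) e f) × r ↭ f ∷ r′
  partner {k} {e} {r} {y} {u} inv J y≢u nonterminal with All-decide candidate r
    where
    candidate : ∀ f → (cross (single y) f ≡ true → Σ (Blocker (e ∷ r) y u) λ B → cross (set B) f ≡ true) ⊎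
      (cross (single y) f ≡ true × Safe k (e ∷ r) e f)
    candidate f with cross (single y) f ≟ᵇ true | safe-or-blocked inv e f
    ... | no ¬touch | _         = inj₁ λ touch → contradiction touch ¬touch
    ... | yes touch | inj₁ safe = inj₂ (touch , safe)
    ... | yes _     | inj₂ (i , X , m , ce , cf) =
      inj₁ λ _ → record { minCut = m ; separates = ≡.trans (sym (J X)) ce } , cf
  ... | inj₂ any = extract any
  ... | inj₁ all = ⊥-elim (absurd (merge-all J all))
    where
    e-touches : cross (single y) e ≡ true
    e-touches = ≡.trans (J (single y)) (cong₂ _xor_ (single-refl y) (single-≢ y≢u))

    cutParity-empty : ∀ es → cutParity (λ _ → false) es ≡ false
    cutParity-empty []       = refl
    cutParity-empty (_ ∷ es) = cutParity-empty es

    absurd : All (λ f → cross (single y) f ≡ false) r ⊎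
      (Σ (Blocker (e ∷ r) y u) λ B → All (λ f → cross (single y) f ≡ true → cross (set B) f ≡ true) r) → ⊥
    -- With no other edge at `y`, exactly one edge crosses `single y`, yet this cut must have the
    -- parity of the empty one.
    absurd (inj₁ clear) = contradiction
      (≡.trans (sym (cong₂ _xor_ e-touches (cutParity-uncrossed {X = single y} clear)))
        (≡.trans (parity inv {single y} {λ _ → false} λ j → single-≢ (nonterminal j ∘ sym)) (cutParity-empty (e ∷ r)))) λ ()
    absurd (inj₂ (B , bs)) = <-irrefl refl (<-≤-trans smaller (minimal (minCut B) flip-isolates))
      where
      X : Cut N
      X = set B

      flip-isolates : Isolates (index B) (flip y X)
      flip-isolates = isolating λ j → ≡.trans (cong (X (t j) xor_) (single-≢ (nonterminal j ∘ sym)))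
        (≡.trans (xor-identityʳ _) (at-terminal (isolates (minCut B)) j))

      smaller : cutSize (flip y X) (e ∷ r) < cutSize X (e ∷ r)
      smaller rewrite cross-flip y X e | e-touches | J X | separates B = s≤s (cutSize-flip-≤ bs)

  -- A cut crossed by both `e` and `f` loses two edges, which safety allows; every other cut keeps
  -- its size. Parities never change.
  split-off : ∀ {k e f g r} → Invariant k (e ∷ f ∷ r) → Safe k (e ∷ f ∷ r) e f →
    (∀ X → cross X g ≡ cross X e xor cross X f) → Invariant k (g ∷ r)
  split-off {k} {e} {f} {g} {r} inv safe sum = record
    { cuts-large = λ {i} {X} I → large I (cross X e) refl (cross X f) refl
    ; parity     = λ {X} {Z} same → ≡.trans (unsplit X) (≡.trans (parity inv {X} {Z} same) (sym (unsplit Z)))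
    }
    where
    unsplit : ∀ X → cutParity X (g ∷ r) ≡ cutParity X (e ∷ f ∷ r)
    unsplit X = ≡.trans (cong (_xor cutParity X r) (sum X)) (xor-assoc (cross X e) (cross X f) _)

    large : ∀ {i X} → Isolates i X → ∀ a → cross X e ≡ a → ∀ b → cross X f ≡ b → k ≤ cutSize X (g ∷ r)
    large {X = X} I a ce b cf with safe I | cuts-large inv I
    large {X = X} I true  ce true  cf | far | _ rewrite sum X | ce | cf = s≤s⁻¹ (s≤s⁻¹ (far refl refl))
    large {X = X} I true  ce false cf | _ | far rewrite sum X | ce | cf = far
    large {X = X} I false ce b     cf | _ | far rewrite sum X | ce | cf = far

-- Packings

Colouring : ∀ {N} → List (Edge N) → Set
Colouring = All (λ _ → ℕ)

colourSum : ∀ {N} → ℕ → Cut N → {es : List (Edge N)} → Colouring es → Bool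
colourSum i X []                 = false
colourSum i X (_∷_ {x = e} c cs) = ((c ≡ᵇ i) ∧ cross X e) xor colourSum i X cs

-- The colours 0, …, k-1 are disjoint chains; a chain has boundary v₁ + … + vₘ exactly when
-- each cut X contains as many of its edges, modulo 2, as there are vertices v₁, …, vₘ in X.
-- Edges with a colour ≥ k are unused.
Packing : ∀ {N} → (Cut N → Bool) → ℕ → List (Edge N) → Set
Packing τ k es = Σ (Colouring es) λ cs → ∀ i → i < k → ∀ X → colourSum i X cs ≡ τ X

colourSum-↭ : ∀ {N} i (X : Cut N) {es es′} (p : es ↭ es′) (cs : Colouring es) →
  colourSum i X (All-resp-↭ p cs) ≡ colourSum i X cs
colourSum-↭ i X refl         cs           = refl
colourSum-↭ i X (prep e p)   (c ∷ cs)     = cong (((c ≡ᵇ i) ∧ cross X e) xor_) (colourSum-↭ i X p cs)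
colourSum-↭ i X (swap e f p) (c ∷ d ∷ cs) = ≡.trans
  (cong (λ b → ((d ≡ᵇ i) ∧ cross X f) xor (((c ≡ᵇ i) ∧ cross X e) xor b)) (colourSum-↭ i X p cs))
  (xor-left-comm ((d ≡ᵇ i) ∧ cross X f) ((c ≡ᵇ i) ∧ cross X e) _)
colourSum-↭ i X (trans p q)  cs           = ≡.trans (colourSum-↭ i X q (All-resp-↭ p cs)) (colourSum-↭ i X p cs)

packing-↭ : ∀ {N τ k} {es es′ : List (Edge N)} → es ↭ es′ → Packing τ k es′ → Packing τ k es
packing-↭ p (cs , ok) = All-resp-↭ (↭-sym p) cs , λ i i<k X → ≡.trans (colourSum-↭ i X (↭-sym p) cs) (ok i i<k X)

-- Both halves inherit the colour of `g` and together contribute to each cut what `g` did.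
packing-unsplit : ∀ {N τ k} {e f g : Edge N} {r} → (∀ X → cross X g ≡ cross X e xor cross X f) →
  Packing τ k (g ∷ r) → Packing τ k (e ∷ f ∷ r)
packing-unsplit {e = e} {f} sum (c ∷ cs , ok) = c ∷ c ∷ cs , λ i i<k X → ≡.trans
  (sym (≡.trans (cong (_xor colourSum i X cs) (≡.trans (cong ((c ≡ᵇ i) ∧_) (sum X)) (∧-distribˡ-xor (c ≡ᵇ i) _ _)))
    (xor-assoc ((c ≡ᵇ i) ∧ cross X e) _ _)))
  (ok i i<k X)

packing-suc : ∀ {N τ k} {r : List (Edge N)} J → (∀ X → cutParity X J ≡ τ X) → Packing τ k r → Packing τ (suc k) (J ++ r)
packing-suc {τ = τ} {k} {r} J join (cs , ok) = paint J , λ { zero _ X → ≡.trans (new J X) (join X)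
                                                           ; (suc i) (s≤s i<k) X → ≡.trans (old J i X) (ok i i<k X) }
  where
  paint : ∀ J → Colouring (J ++ r)
  paint []      = All-map suc cs
  paint (_ ∷ J) = 0 ∷ paint J

  new-shifted : ∀ {r} X (cs : Colouring r) → colourSum 0 X (All-map suc cs) ≡ false
  new-shifted X []       = refl
  new-shifted X (_ ∷ cs) = new-shifted X cs

  new : ∀ J X → colourSum 0 X (paint J) ≡ cutParity X J
  new []      X = new-shifted X cs
  new (e ∷ J) X = cong (cross X e xor_) (new J X)

  old-shifted : ∀ {r} i X (cs : Colouring r) → colourSum (suc i) X (All-map suc cs) ≡ colourSum i X cs
  old-shifted i X []       = refl
  old-shifted i X (c ∷ cs) = cong (((c ≡ᵇ i) ∧ _) xor_) (old-shifted i X cs)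

  old : ∀ J i X → colourSum (suc i) X (paint J) ≡ colourSum i X cs
  old []      i X = old-shifted i X cs
  old (_ ∷ J) i X = old J i X

packing-zero : ∀ {N τ} (es : List (Edge N)) → Packing τ 0 es
packing-zero es = universal (λ _ → 0) es , λ _ ()

-- Edges between terminals only

degreeIn : ∀ {N} → Fin N → List (Edge N) → ℕ
degreeIn v = cutSize (single v)

degree-drop : ∀ {N k} {v : Fin N} {e es r} → es ↭ e ∷ r → suc k ≤ degreeIn v es → k ≤ degreeIn v r
degree-drop {v = v} {e} p le with cross (single v) e | ≤-trans le (≤-reflexive (cutSize-↭ (single v) p))
... | true  | le′ = s≤s⁻¹ le′
... | false | le′ = ≤-trans (n≤1+n _) le′

degree-keep : ∀ {N k} {v a b : Fin N} {e es r} → es ↭ e ∷ r → Joins e a b → v ≢ a → v ≢ b →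
  k ≤ degreeIn v es → k ≤ degreeIn v r
degree-keep {v = v} {r = r} p J v≢a v≢b le = ≤-trans le (≤-reflexive (≡.trans (cutSize-↭ (single v) p)
  (cong (λ b → ι b + degreeIn v r) (≡.trans (J (single v)) (cong₂ _xor_ (single-≢ v≢a) (single-≢ v≢b))))))

terminalSum : ∀ {N} → (Fin 4 → Fin N) → Cut N → Bool
terminalSum t X = X (t zero) xor (X (t (suc zero)) xor (X (t (suc (suc zero))) xor X (t (suc (suc (suc zero))))))

module FourTerminals {N : ℕ} (t : Fin 4 → Fin N) (t-injective : ∀ {i j} → t i ≡ t j → i ≡ j) where

  Between : Fin 4 → Fin 4 → Edge N → Set
  Between i j f = f ≡ (t i , t j) ⊎ f ≡ (t j , t i)

  between? : ∀ i j f → Dec (Between i j f)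
  between? i j f = ≡-dec _≟_ _≟_ f (t i , t j) ⊎-dec ≡-dec _≟_ _≟_ f (t j , t i)

  between-sym : ∀ {i j f} → Between i j f → Between j i f
  between-sym (inj₁ eq) = inj₂ eq
  between-sym (inj₂ eq) = inj₁ eq

  between-joins : ∀ {i j f} → Between i j f → Joins f (t i) (t j)
  between-joins         (inj₁ refl) X = refl
  between-joins {i} {j} (inj₂ refl) X = xor-comm (X (t j)) (X (t i))

  Inner : Edge N → Set
  Inner f = proj₁ f ≡ proj₂ f ⊎ Σ (Fin 4) λ i → Σ (Fin 4) λ j → i ≢ j × f ≡ (t i , t j)

  inner-at : ∀ v {f} → Inner f → cross (single (t v)) f ≡ true → Σ (Fin 4) λ w → v ≢ w × Between v w f
  inner-at v {f} (inj₁ refl) c = contradiction (≡.trans (sym c) (xor-same (single (t v) (proj₁ f)))) λ ()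
  inner-at v (inj₂ (i , j , i≢j , refl)) c with v ≟ i | v ≟ j
  ... | yes refl | _        = j , i≢j , inj₁ refl
  ... | no _     | yes refl = i , i≢j ∘ sym , inj₂ refl
  ... | no v≢i   | no v≢j   = contradiction
    (≡.trans (sym c) (cong₂ _xor_ (single-≢ (v≢i ∘ t-injective)) (single-≢ (v≢j ∘ t-injective)))) λ ()

  -- A relabelling of the terminals. The last clause, independence of the sum from the order, is
  -- phrased with Boolean values so that concrete arrangements are verified by computation.
  Arrangement : (a b c d : Fin 4) → Set
  Arrangement a b c d =
    (∀ i → i ≡ a ⊎ i ≡ b ⊎ i ≡ c ⊎ i ≡ d)
    × (a ≢ b × a ≢ c × a ≢ d × b ≢ c × b ≢ d × c ≢ d)
    × (∀ p q r s → let f = lookup (p ∷ q ∷ r ∷ s ∷ []) in f a xor (f b xor (f c xor f d)) ≡ p xor (q xor (r xor s)))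

  arrangement? : ∀ a b c d → Dec (Arrangement a b c d)
  arrangement? a b c d =
    (all? λ i → (i ≟ a) ⊎-dec (i ≟ b) ⊎-dec (i ≟ c) ⊎-dec (i ≟ d))
    ×-dec (¬? (a ≟ b) ×-dec ¬? (a ≟ c) ×-dec ¬? (a ≟ d) ×-dec ¬? (b ≟ c) ×-dec ¬? (b ≟ d) ×-dec ¬? (c ≟ d))
    ×-dec (∀Bool? λ p → ∀Bool? λ q → ∀Bool? λ r → ∀Bool? λ s →
      let f = lookup (p ∷ q ∷ r ∷ s ∷ []) in f a xor (f b xor (f c xor f d)) ≟ᵇ p xor (q xor (r xor s)))

  arranged-sum : ∀ {a b c d} → Arrangement a b c d → ∀ X →
    X (t a) xor (X (t b) xor (X (t c) xor X (t d))) ≡ terminalSum t X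
  arranged-sum {a} {b} {c} {d} (_ , _ , sums) X = ≡.trans
    (sym (cong₂ _xor_ (at a) (cong₂ _xor_ (at b) (cong₂ _xor_ (at c) (at d))))) (sums _ _ _ _)
    where
    at : ∀ i → lookup (tabulate (X ∘ t)) i ≡ X (t i)
    at = lookup∘tabulate (X ∘ t)

  Present Absent : Fin 4 → Fin 4 → List (Edge N) → Set
  Present i j = Any (Between i j)
  Absent i j  = All (λ f → ¬ Between i j f)

  -- The two removed edges are distinct and together meet each terminal once, so they form a chain
  -- with the right boundary and cost every terminal one degree.
  matching : ∀ {a b c d k es} → Arrangement a b c d → All Inner es → (∀ i → suc k ≤ degreeIn (t i) es) →
    Present a b es → Present c d es →
    Σ (List (Edge N)) λ r → All Inner r × (∀ i → k ≤ degreeIn (t i) r) ×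
      (Packing (terminalSum t) k r → Packing (terminalSum t) (suc k) es)
  matching {a} {b} {c} {d} {k} {es} arr@(cover , (a≢b , a≢c , a≢d , b≢c , b≢d , c≢d) , _) inner deg ab cd with extract ab
  ... | e , r , Be , p with extract (remaining p cd)
    where
    remaining : ∀ {r} → es ↭ _ ∷ r → Present c d es → Present c d r
    remaining p cd with Any-resp-↭ p cd
    ... | there cd′ = cd′
    ... | here Be′  = ⊥-elim (apart Be Be′)
      where
      apart : Between a b e → Between c d e → ⊥
      apart (inj₁ refl) (inj₁ eq) = a≢c (t-injective (cong proj₁ eq))
      apart (inj₁ refl) (inj₂ eq) = a≢d (t-injective (cong proj₁ eq))
      apart (inj₂ refl) (inj₁ eq) = b≢c (t-injective (cong proj₁ eq))
      apart (inj₂ refl) (inj₂ eq) = b≢d (t-injective (cong proj₁ eq))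
  ...   | f , r′ , Bf , q = r′ , inner′ , deg′ , λ pk →
    packing-↭ (trans p (prep e q)) (packing-suc (e ∷ f ∷ []) join pk)
    where
    inner′ : All Inner r′
    inner′ with All-resp-↭ (trans p (prep e q)) inner
    ... | _ ∷ _ ∷ ps = ps

    off-e : ∀ v → v ≢ a → v ≢ b → k ≤ degreeIn (t v) r′
    off-e v v≢a v≢b = degree-drop q (degree-keep p (between-joins Be) (v≢a ∘ t-injective) (v≢b ∘ t-injective) (deg v))

    off-f : ∀ v → v ≢ c → v ≢ d → k ≤ degreeIn (t v) r′
    off-f v v≢c v≢d = degree-keep q (between-joins Bf) (v≢c ∘ t-injective) (v≢d ∘ t-injective) (degree-drop p (deg v))

    deg′ : ∀ i → k ≤ degreeIn (t i) r′
    deg′ i with cover i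
    ... | inj₁ refl               = off-f a a≢c a≢d
    ... | inj₂ (inj₁ refl)        = off-f b b≢c b≢d
    ... | inj₂ (inj₂ (inj₁ refl)) = off-e c (a≢c ∘ sym) (b≢c ∘ sym)
    ... | inj₂ (inj₂ (inj₂ refl)) = off-e d (a≢d ∘ sym) (b≢d ∘ sym)

    join : ∀ X → cutParity X (e ∷ f ∷ []) ≡ terminalSum t X
    join X = ≡.trans (≡.trans (cong₂ (λ p q → p xor (q xor false)) (between-joins Be X) (between-joins Bf X))
      (from-yes (∀Bool? λ p → ∀Bool? λ q → ∀Bool? λ r → ∀Bool? λ s →
        (p xor q) xor ((r xor s) xor false) ≟ᵇ p xor (q xor (r xor s))) (X (t a)) (X (t b)) (X (t c)) (X (t d))))
      (arranged-sum arr X)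

  Spoke : Fin 4 → Edge N → Set
  Spoke a f = Inner f × (∀ i j → i ≢ j → i ≢ a → j ≢ a → ¬ Between i j f)

  spoke-edge : ∀ {a k es v} → v ≢ a → All (Spoke a) es → suc k ≤ degreeIn (t v) es →
    Σ (Edge N) λ e → Σ (List (Edge N)) λ r → Spoke a e × Joins e (t a) (t v) × es ↭ e ∷ r
  spoke-edge {a} {v = v} v≢a spokes le with extract (crossing-edge (single (t v)) spokes le)
  ... | e , r , (spoke@(inner , off) , c) , p with inner-at v inner c
  ...   | w , v≢w , B with w ≟ a
  ...     | yes refl = e , r , spoke , between-joins (between-sym B) , p
  ...     | no w≢a   = ⊥-elim (off v w v≢w v≢a w≢a B)

  -- Every edge that counts at a leaf leads to the hub `a`, so the leaf degrees supply the spokes.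
  -- One spoke from each leaf gives the hub degree 3, which is 1 modulo 2.
  star : ∀ {a b c d} → Arrangement a b c d → ∀ k {es} → All (Spoke a) es →
    k ≤ degreeIn (t b) es → k ≤ degreeIn (t c) es → k ≤ degreeIn (t d) es → Packing (terminalSum t) k es
  star arr zero {es} spokes _ _ _ = packing-zero es
  star {a} {b} {c} {d} arr@(_ , (a≢b , a≢c , a≢d , b≢c , b≢d , c≢d) , _) (suc k) {es} spokes db dc dd
    with spoke-edge (a≢b ∘ sym) spokes db
  ... | e , r , _ , Je , p with All-resp-↭ p spokes
  ...   | _ ∷ spokes₁ with spoke-edge (a≢c ∘ sym) spokes₁ (away c dc a≢c b≢c)
    where
    away : ∀ v → suc k ≤ degreeIn (t v) es → a ≢ v → b ≢ v → suc k ≤ degreeIn (t v) r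
    away v dv a≢v b≢v = degree-keep p Je (a≢v ∘ t-injective ∘ sym) (b≢v ∘ t-injective ∘ sym) dv
  ...     | f , r₁ , _ , Jf , p₁ with All-resp-↭ p₁ spokes₁
  ...       | _ ∷ spokes₂ with spoke-edge (a≢d ∘ sym) spokes₂
                (degree-keep p₁ Jf (a≢d ∘ t-injective ∘ sym) (c≢d ∘ t-injective ∘ sym)
                  (degree-keep p Je (a≢d ∘ t-injective ∘ sym) (b≢d ∘ t-injective ∘ sym) dd))
  ...         | g , r₂ , _ , Jg , p₂ with All-resp-↭ p₂ spokes₂
  ...           | _ ∷ spokes₃ = packing-↭ (trans p (prep e (trans p₁ (prep f p₂))))
    (packing-suc (e ∷ f ∷ g ∷ []) join (star arr k spokes₃ db′ dc′ dd′))
    where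
    db′ : k ≤ degreeIn (t b) r₂
    db′ = degree-keep p₂ Jg (a≢b ∘ t-injective ∘ sym) (b≢d ∘ t-injective)
      (degree-keep p₁ Jf (a≢b ∘ t-injective ∘ sym) (b≢c ∘ t-injective) (degree-drop p db))

    dc′ : k ≤ degreeIn (t c) r₂
    dc′ = degree-keep p₂ Jg (a≢c ∘ t-injective ∘ sym) (c≢d ∘ t-injective)
      (degree-drop p₁ (degree-keep p Je (a≢c ∘ t-injective ∘ sym) (b≢c ∘ t-injective ∘ sym) dc))

    dd′ : k ≤ degreeIn (t d) r₂
    dd′ = degree-drop p₂ (degree-keep p₁ Jf (a≢d ∘ t-injective ∘ sym) (c≢d ∘ t-injective ∘ sym)
      (degree-keep p Je (a≢d ∘ t-injective ∘ sym) (b≢d ∘ t-injective ∘ sym) dd))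

    join : ∀ X → cutParity X (e ∷ f ∷ g ∷ []) ≡ terminalSum t X
    join X = ≡.trans (≡.trans
      (cong₂ _xor_ (Je X) (cong₂ (λ p q → p xor (q xor false)) (Jf X) (Jg X)))
      (from-yes (∀Bool? λ p → ∀Bool? λ q → ∀Bool? λ r → ∀Bool? λ s →
        (p xor q) xor ((p xor r) xor ((p xor s) xor false)) ≟ᵇ p xor (q xor (r xor s))) (X (t a)) (X (t b)) (X (t c)) (X (t d))))
      (arranged-sum arr X)

  no-triangle : ∀ {a b c d k es} → Arrangement a b c d → All Inner es → (∀ i → k ≤ degreeIn (t i) es) →
    Absent b c es → Absent b d es → Absent c d es → Packing (terminalSum t) k es
  no-triangle {a} {b} {c} {d} {k} arr@(cover , _) inner deg bc bd cd =
    star arr k (All-zip (inner , All-map off (All-zip (bc , All-zip (bd , cd))))) (deg b) (deg c) (deg d)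
    where
    off : ∀ {f} → (¬ Between b c f) × (¬ Between b d f) × (¬ Between c d f) →
      ∀ i j → i ≢ j → i ≢ a → j ≢ a → ¬ Between i j f
    off (bc , bd , cd) i j i≢j i≢a j≢a B with cover i | cover j
    ... | inj₁ i≡a | _ = i≢a i≡a
    ... | _ | inj₁ j≡a = j≢a j≡a
    ... | inj₂ (inj₁ refl)        | inj₂ (inj₁ refl)        = i≢j refl
    ... | inj₂ (inj₁ refl)        | inj₂ (inj₂ (inj₁ refl)) = bc B
    ... | inj₂ (inj₁ refl)        | inj₂ (inj₂ (inj₂ refl)) = bd B
    ... | inj₂ (inj₂ (inj₁ refl)) | inj₂ (inj₁ refl)        = bc (between-sym B)
    ... | inj₂ (inj₂ (inj₁ refl)) | inj₂ (inj₂ (inj₁ refl)) = i≢j refl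
    ... | inj₂ (inj₂ (inj₁ refl)) | inj₂ (inj₂ (inj₂ refl)) = cd B
    ... | inj₂ (inj₂ (inj₂ refl)) | inj₂ (inj₁ refl)        = bd (between-sym B)
    ... | inj₂ (inj₂ (inj₂ refl)) | inj₂ (inj₂ (inj₁ refl)) = cd (between-sym B)
    ... | inj₂ (inj₂ (inj₂ refl)) | inj₂ (inj₂ (inj₂ refl)) = i≢j refl

  not-isolated : ∀ {a b c d k es} → Arrangement a b c d → All Inner es → suc k ≤ degreeIn (t a) es →
    Absent a b es → Absent a c es → Absent a d es → ⊥
  not-isolated {a} (cover , _) inner deg ab ac ad
    with extract (crossing-edge (single (t a)) (All-zip (inner , All-zip (ab , All-zip (ac , ad)))) deg)
  ... | e , r , ((inn , nab , nac , nad) , c) , _ with inner-at a inn c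
  ...   | w , a≢w , B with cover w
  ...     | inj₁ refl               = a≢w refl
  ...     | inj₂ (inj₁ refl)        = nab B
  ...     | inj₂ (inj₂ (inj₁ refl)) = nac B
  ...     | inj₂ (inj₂ (inj₂ refl)) = nad B

  present-or-absent : ∀ a b c d es → (Present a b es × Present c d es) ⊎ Absent a b es ⊎ Absent c d es
  present-or-absent a b c d es with any? (between? a b) es | any? (between? c d) es
  ... | yes ab | yes cd = inj₁ (ab , cd)
  ... | no ¬ab | _      = inj₂ (inj₁ (¬Any⇒All¬ es ¬ab))
  ... | _      | no ¬cd = inj₂ (inj₂ (¬Any⇒All¬ es ¬cd))

  inner-packing : ∀ k {es} → All Inner es → (∀ i → k ≤ degreeIn (t i) es) → Packing (terminalSum t) k es
  inner-packing zero {es} _ _ = packing-zero es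
  inner-packing (suc k) {es} inner deg = cases (present-or-absent 0F 1F 2F 3F es) (present-or-absent 0F 2F 1F 3F es) (present-or-absent 0F 3F 1F 2F es)
    where
    Result : Set
    Result = Packing (terminalSum t) (suc k) es

    Pairing : (a b c d : Fin 4) → Set
    Pairing a b c d = (Present a b es × Present c d es) ⊎ Absent a b es ⊎ Absent c d es

    by-matching : ∀ {a b c d} → Arrangement a b c d → Present a b es × Present c d es → Result
    by-matching arr (ab , cd) with matching arr inner deg ab cd
    ... | r , inner′ , deg′ , extend = extend (inner-packing k inner′ deg′)

    absent-sym : ∀ {i j} → Absent i j es → Absent j i es
    absent-sym = All-map (_∘ between-sym)

    cases : Pairing 0F 1F 2F 3F → Pairing 0F 2F 1F 3F → Pairing 0F 3F 1F 2F → Result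
    cases (inj₁ m) _ _ = by-matching (from-yes (arrangement? 0F 1F 2F 3F)) m
    cases _ (inj₁ m) _ = by-matching (from-yes (arrangement? 0F 2F 1F 3F)) m
    cases _ _ (inj₁ m) = by-matching (from-yes (arrangement? 0F 3F 1F 2F)) m
    -- Each of the three matchings lacks a pair. The three absent pairs either share a terminal,
    -- contradicting its positive degree, or form a triangle, and then all edges that are not loops
    -- meet the fourth terminal.
    cases (inj₂ (inj₁ p01)) (inj₂ (inj₁ p02)) (inj₂ (inj₁ p03)) =
      ⊥-elim (not-isolated (from-yes (arrangement? 0F 1F 2F 3F)) inner (deg 0F) p01 p02 p03)
    cases (inj₂ (inj₁ p01)) (inj₂ (inj₂ p13)) (inj₂ (inj₂ p12)) =
      ⊥-elim (not-isolated (from-yes (arrangement? 1F 0F 2F 3F)) inner (deg 1F) (absent-sym p01) p12 p13)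
    cases (inj₂ (inj₂ p23)) (inj₂ (inj₁ p02)) (inj₂ (inj₂ p12)) =
      ⊥-elim (not-isolated (from-yes (arrangement? 2F 0F 1F 3F)) inner (deg 2F) (absent-sym p02) (absent-sym p12) p23)
    cases (inj₂ (inj₂ p23)) (inj₂ (inj₂ p13)) (inj₂ (inj₁ p03)) =
      ⊥-elim (not-isolated (from-yes (arrangement? 3F 0F 1F 2F)) inner (deg 3F) (absent-sym p03) (absent-sym p13) (absent-sym p23))
    cases (inj₂ (inj₂ p23)) (inj₂ (inj₂ p13)) (inj₂ (inj₂ p12)) = no-triangle (from-yes (arrangement? 0F 1F 2F 3F)) inner deg p12 p13 p23
    cases (inj₂ (inj₂ p23)) (inj₂ (inj₁ p02)) (inj₂ (inj₁ p03)) = no-triangle (from-yes (arrangement? 1F 0F 2F 3F)) inner deg p02 p03 p23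
    cases (inj₂ (inj₁ p01)) (inj₂ (inj₂ p13)) (inj₂ (inj₁ p03)) = no-triangle (from-yes (arrangement? 2F 0F 1F 3F)) inner deg p01 p03 p13
    cases (inj₂ (inj₁ p01)) (inj₂ (inj₁ p02)) (inj₂ (inj₂ p12)) = no-triangle (from-yes (arrangement? 3F 0F 1F 2F)) inner deg p01 p02 p12

  -- Reduction to edges between terminals

  open Terminals t
  open Invariant

  Free : Edge N → Set
  Free e = Σ (Fin N) λ y → Σ (Fin N) λ u → Joins e y u × y ≢ u × (∀ j → t j ≢ y)

  inner-or-free : ∀ e → Inner e ⊎ Free e
  inner-or-free (a , b) with a ≟ b | anyFin? (λ j → t j ≟ a) | anyFin? (λ j → t j ≟ b)
  ... | yes a≡b | _              | _              = inj₁ (inj₁ a≡b)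
  ... | no a≢b  | no a∉T         | _              = inj₂ (a , b , (λ _ → refl) , a≢b , λ j eq → a∉T (j , eq))
  ... | no a≢b  | _              | no b∉T         = inj₂ (b , a , (λ X → xor-comm (X a) (X b)) , a≢b ∘ sym , λ j eq → b∉T (j , eq))
  ... | no a≢b  | yes (i , refl) | yes (j , refl) = inj₁ (inj₂ (i , j , a≢b ∘ cong t , refl))

  -- Each splitting-off puts one edge, possibly a loop, in the place of two, so the bound `n` on the
  -- length decreases.
  invariant-packing : ∀ {k} n {es} → length es ≤ n → Invariant k es → Packing (terminalSum t) k es
  invariant-packing {k} n {es} len inv with All-decide inner-or-free es
  -- A single terminal is itself an isolating cut, so the cut condition bounds its degree.
  ... | inj₁ inner = inner-packing k inner λ i → cuts-large inv (isolating λ j → single-t i j)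
    where
    single-t : ∀ i j → single (t i) (t j) ≡ ⌊ i ≟ j ⌋
    single-t i j with i ≟ j
    ... | yes refl = single-refl (t i)
    ... | no i≢j   = single-≢ (i≢j ∘ t-injective)
  ... | inj₂ free with extract free
  ...   | e , r , (y , u , J , y≢u , y∉T) , p with partner (invariant-↭ p inv) J y≢u y∉T
  ...     | f , r′ , (touch , safe) , p′ with touching-joins y f touch | n | ≤-trans (≤-reflexive (sym (↭-length (trans p (prep e p′))))) len
  ...       | w , Jf | suc n′ | s≤s len′ =
    packing-↭ (trans p (prep e p′)) (packing-unsplit sum (invariant-packing n′ len′
      (split-off (invariant-↭ (trans p (prep e p′)) inv) safe′ sum)))
    where
    sum : ∀ X → cross X (u , w) ≡ cross X e xor cross X f
    sum X rewrite J X | Jf X = from-yes (∀Bool? λ a → ∀Bool? λ b → ∀Bool? λ c →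
      b xor c ≟ᵇ (a xor b) xor (a xor c)) (X y) (X u) (X w)

    safe′ : Safe k (e ∷ f ∷ r′) e f
    safe′ {X = X} I ce cf = ≤-trans (safe I ce cf) (≤-reflexive (cutSize-↭ X (prep e p′)))

-- Sums over 𝔽₂

xorSum-cong : ∀ m {f g : Fin m → Bool} → (∀ i → f i ≡ g i) → xorSum m f ≡ xorSum m g
xorSum-cong zero    f≡g = refl
xorSum-cong (suc m) f≡g = cong₂ _xor_ (f≡g zero) (xorSum-cong m (f≡g ∘ suc))

xorSum-false : ∀ m {f : Fin m → Bool} → (∀ i → f i ≡ false) → xorSum m f ≡ false
xorSum-false zero    f≡0 = refl
xorSum-false (suc m) f≡0 = cong₂ _xor_ (f≡0 zero) (xorSum-false m (f≡0 ∘ suc))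

xorSum-single : ∀ m {f : Fin m → Bool} a → (∀ i → i ≢ a → f i ≡ false) → xorSum m f ≡ f a
xorSum-single (suc m) {f} zero    off = ≡.trans (cong (f zero xor_) (xorSum-false m λ i → off (suc i) λ ())) (xor-identityʳ _)
xorSum-single (suc m)     (suc a) off = cong₂ _xor_ (off zero λ ()) (xorSum-single m a λ i i≢a → off (suc i) (i≢a ∘ suc-injective))

xorSum-xor : ∀ m (f g : Fin m → Bool) → xorSum m (λ i → f i xor g i) ≡ xorSum m f xor xorSum m g
xorSum-xor zero    f g = refl
xorSum-xor (suc m) f g = ≡.trans (cong ((f zero xor g zero) xor_) (xorSum-xor m (f ∘ suc) (g ∘ suc)))
  (xor-interchange (f zero) (g zero) (xorSum m (f ∘ suc)) (xorSum m (g ∘ suc)))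

xorSum-∧-single : ∀ {N} (X : Cut N) a → xorSum N (λ v → X v ∧ single v a) ≡ X a
xorSum-∧-single {N} X a = ≡.trans
  (xorSum-single N a λ v v≢a → ≡.trans (cong (X v ∧_) (single-≢ v≢a)) (∧-zeroʳ (X v)))
  (≡.trans (cong (X a ∧_) (single-refl a)) (∧-identityʳ (X a)))

xorSum-∧-cross : ∀ {N} (X : Cut N) e → xorSum N (λ v → X v ∧ cross (single v) e) ≡ cross X e
xorSum-∧-cross {N} X (a , b) = ≡.trans
  (xorSum-cong N λ v → ∧-distribˡ-xor (X v) (single v a) (single v b))
  (≡.trans (xorSum-xor N _ _) (cong₂ _xor_ (xorSum-∧-single X a) (xorSum-∧-single X b)))

-- Discrete Stokes theorem: ∂p paired with X is p paired with the coboundary of X.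
xorSum-boundary : ∀ {N} m (ends : Fin m → Edge N) (p : Chain m) X →
  xorSum N (λ v → X v ∧ xorSum m (λ e → p e ∧ cross (single v) (ends e))) ≡ xorSum m (λ e → p e ∧ cross X (ends e))
xorSum-boundary {N} zero    ends p X = xorSum-false N λ v → ∧-zeroʳ (X v)
xorSum-boundary {N} (suc m) ends p X = ≡.trans
  (xorSum-cong N λ v → ∧-distribˡ-xor (X v) _ _)
  (≡.trans (xorSum-xor N _ _) (cong₂ _xor_ (first (p zero) (ends zero)) (xorSum-boundary m (ends ∘ suc) (p ∘ suc) X)))
  where
  first : ∀ b e → xorSum N (λ v → X v ∧ (b ∧ cross (single v) e)) ≡ b ∧ cross X e
  first true  e = xorSum-∧-cross X e
  first false e = xorSum-false N λ v → ∧-zeroʳ (X v)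

xorSum≡odd : ∀ m (f : Fin m → Bool) → xorSum m f ≡ odd (countTrue m f)
xorSum≡odd zero    f = refl
xorSum≡odd (suc m) f with f zero
... | true  = cong not (xorSum≡odd m (f ∘ suc))
... | false = xorSum≡odd m (f ∘ suc)

countTrue-cong : ∀ m {f g : Fin m → Bool} → (∀ i → f i ≡ g i) → countTrue m f ≡ countTrue m g
countTrue-cong zero    f≡g = refl
countTrue-cong (suc m) f≡g = cong₂ (λ b n → ι b + n) (f≡g zero) (countTrue-cong m (f≡g ∘ suc))

countTrue-splitAt : ∀ {A : Set} (h : A → Bool) m n (f : Fin m → A) (g : Fin n → A) →
  countTrue (m + n) (λ i → h ([ f , g ] (splitAt m i))) ≡ countTrue m (h ∘ f) + countTrue n (h ∘ g)
countTrue-splitAt h zero    n f g = refl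
countTrue-splitAt h (suc m) n f g = ≡.trans
  (cong (ι (h (f zero)) +_) (≡.trans (countTrue-cong (m + n) tail) (countTrue-splitAt h m n (f ∘ suc) g)))
  (sym (+-assoc (ι (h (f zero))) _ _))
  where
  tail : ∀ i → h ([ f , g ] (splitAt (suc m) (suc i))) ≡ h ([ f ∘ suc , g ] (splitAt m i))
  tail i with splitAt m i
  ... | inj₁ _ = refl
  ... | inj₂ _ = refl

odd-+ : ∀ m n → odd (m + n) ≡ odd m xor odd n
odd-+ zero    n = refl
odd-+ (suc m) n = ≡.trans (cong not (odd-+ m n)) (not-distribˡ-xor (odd m) (odd n))

odd⇒%2≡1 : ∀ n → odd n ≡ true → n % 2 ≡ 1
odd⇒%2≡1 (suc zero)    _ = refl
odd⇒%2≡1 (suc (suc n)) o = odd⇒%2≡1 n (≡.trans (sym (not-involutive (odd n))) o)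

%2≡1⇒odd : ∀ n → n % 2 ≡ 1 → odd n ≡ true
%2≡1⇒odd (suc zero)    _  = refl
%2≡1⇒odd (suc (suc n)) eq = ≡.trans (not-involutive (odd n)) (%2≡1⇒odd n eq)

-- From indexed edges to edge lists and back

cutSize-tabulate : ∀ {N} (X : Cut N) m (ends : Fin m → Edge N) → cutSize X (List.tabulate ends) ≡ countTrue m (cross X ∘ ends)
cutSize-tabulate X zero    ends = refl
cutSize-tabulate X (suc m) ends = cong (ι (cross X (ends zero)) +_) (cutSize-tabulate X m (ends ∘ suc))

cutParity-tabulate : ∀ {N} (X : Cut N) m (ends : Fin m → Edge N) → cutParity X (List.tabulate ends) ≡ xorSum m (cross X ∘ ends)
cutParity-tabulate X zero    ends = refl
cutParity-tabulate X (suc m) ends = cong (cross X (ends zero) xor_) (cutParity-tabulate X m (ends ∘ suc))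

colourSum-tabulate : ∀ {N} i (X : Cut N) m (ends : Fin m → Edge N) (cs : Colouring (List.tabulate ends)) →
  xorSum m (λ e → (tabulate⁻ cs e ≡ᵇ i) ∧ cross X (ends e)) ≡ colourSum i X cs
colourSum-tabulate i X zero    ends []       = refl
colourSum-tabulate i X (suc m) ends (c ∷ cs) = cong (((c ≡ᵇ i) ∧ cross X (ends zero)) xor_) (colourSum-tabulate i X m (ends ∘ suc) cs)

-- `incident` and `cross ∘ single` differ on loops.
incident≡cross : ∀ {N} (v : Fin N) e → proj₁ e ≢ proj₂ e → incident v e ≡ cross (single v) e
incident≡cross v (a , b) a≢b with v ≟ a | v ≟ b
... | yes refl | yes refl = contradiction refl a≢b
... | yes _    | no _     = refl
... | no _     | _        = refl

bd≡xorSum : ∀ {N m} (ends : Fin m → Edge N) → (∀ e → proj₁ (ends e) ≢ proj₂ (ends e)) → ∀ p v →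
  bd ends p v ≡ xorSum m (λ e → p e ∧ cross (single v) (ends e))
bd≡xorSum {m = m} ends noloop p v = xorSum-cong m λ e → cong (p e ∧_) (incident≡cross v (ends e) (noloop e))

≡ᵇ-disjoint : ∀ c {i j} → i ≢ j → (c ≡ᵇ i) ∧ (c ≡ᵇ j) ≡ false
≡ᵇ-disjoint zero    {zero}  {zero}  i≢j = contradiction refl i≢j
≡ᵇ-disjoint zero    {zero}  {suc _} i≢j = refl
≡ᵇ-disjoint zero    {suc _} {_}     i≢j = refl
≡ᵇ-disjoint (suc c) {zero}  {_}     i≢j = refl
≡ᵇ-disjoint (suc c) {suc i} {zero}  i≢j = ∧-zeroʳ (c ≡ᵇ i)
≡ᵇ-disjoint (suc c) {suc i} {suc j} i≢j = ≡ᵇ-disjoint c (i≢j ∘ cong suc)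

theorem2p8 : (k : ℕ) → 0 < k → (G : Graph)
    → (v₁ v₂ v₃ v₄ : Fin (nV G))
    → v₁ ≢ v₂ → v₁ ≢ v₃ → v₁ ≢ v₄ → v₂ ≢ v₃ → v₂ ≢ v₄ → v₃ ≢ v₄
    -- Y = V ∖ {v₁,v₂,v₃,v₄}; oddY v ⇔ v is one of y₁ … yₘ
    → let isV : Fin (nV G) → Set
          isV v = (v ≡ v₁) ⊎ (v ≡ v₂) ⊎ (v ≡ v₃) ⊎ (v ≡ v₄)
          oddY : Fin (nV G) → Set
          oddY v = (¬ isV v) × (degree G v % 2 ≡ 1)
      in
      -- after deleting any set D of at most k-1 edges there is a chain p
      -- of the remaining graph with ∂(p) = v₁ + v₂ + v₃ + v₄
      ((D : Chain (nE G)) → countTrue (nE G) D < k →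
        Σ (Chain (nE G)) λ p → ((e : Fin (nE G)) → p e ≡ true → D e ≡ false)
          × (bd (ends G) p ≐ sum4 v₁ v₂ v₃ v₄))
    -- GN: new edges ε₁ … εₙ
    → (n : ℕ) → (ε : Fin n → Fin (nV G) × Fin (nV G))
    → ((i : Fin n) → Σ (Fin (nV G)) λ a → Σ (Fin (nV G)) λ b → (ε i ≡ (a , b)) × (a ≢ b)
          × ((oddY a × (isV b ⊎ oddY b)) ⊎ (oddY b × (isV a ⊎ oddY a))))
    → ((y : Fin (nV G)) → oddY y →
          Σ (Fin n) λ i → (incident y (ε i) ≡ true)
            × ((j : Fin n) → incident y (ε j) ≡ true → j ≡ i))
    → Σ (Fin k → Chain (nE G + n)) λ p →
          ((i : Fin k) → bd (extendEnds G n ε) (p i) ≐ sum4 v₁ v₂ v₃ v₄)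
        × ((i j : Fin k) → i ≢ j → NoCommonSummand (p i) (p j))
theorem2p8 k _ G v₁ v₂ v₃ v₄ v₁≢v₂ v₁≢v₃ v₁≢v₄ v₂≢v₃ v₂≢v₄ v₃≢v₄ connected n ε new-edges once = result
  where
  N = nV G
  m = nE G

  t : Fin 4 → Fin N
  t = lookup (v₁ ∷ v₂ ∷ v₃ ∷ v₄ ∷ [])

  t-injective : ∀ {i j} → t i ≡ t j → i ≡ j
  t-injective {0F} {0F} _  = refl
  t-injective {0F} {1F} eq = contradiction eq v₁≢v₂
  t-injective {0F} {2F} eq = contradiction eq v₁≢v₃
  t-injective {0F} {3F} eq = contradiction eq v₁≢v₄
  t-injective {1F} {0F} eq = contradiction (sym eq) v₁≢v₂
  t-injective {1F} {1F} _  = refl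
  t-injective {1F} {2F} eq = contradiction eq v₂≢v₃
  t-injective {1F} {3F} eq = contradiction eq v₂≢v₄
  t-injective {2F} {0F} eq = contradiction (sym eq) v₁≢v₃
  t-injective {2F} {1F} eq = contradiction (sym eq) v₂≢v₃
  t-injective {2F} {2F} _  = refl
  t-injective {2F} {3F} eq = contradiction eq v₃≢v₄
  t-injective {3F} {0F} eq = contradiction (sym eq) v₁≢v₄
  t-injective {3F} {1F} eq = contradiction (sym eq) v₂≢v₄
  t-injective {3F} {2F} eq = contradiction (sym eq) v₃≢v₄
  t-injective {3F} {3F} _  = refl

  open Terminals t
  open FourTerminals t t-injective using (invariant-packing)

  IsV OddY : Fin N → Set
  IsV v  = (v ≡ v₁) ⊎ (v ≡ v₂) ⊎ (v ≡ v₃) ⊎ (v ≡ v₄)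
  OddY v = (¬ IsV v) × (degree G v % 2 ≡ 1)

  isV⇒terminal : ∀ {v} → IsV v → Σ (Fin 4) λ j → v ≡ t j
  isV⇒terminal (inj₁ eq)               = 0F , eq
  isV⇒terminal (inj₂ (inj₁ eq))        = 1F , eq
  isV⇒terminal (inj₂ (inj₂ (inj₁ eq))) = 2F , eq
  isV⇒terminal (inj₂ (inj₂ (inj₂ eq))) = 3F , eq

  isV? : ∀ v → Dec (IsV v)
  isV? v = (v ≟ v₁) ⊎-dec (v ≟ v₂) ⊎-dec (v ≟ v₃) ⊎-dec (v ≟ v₄)

  -- The four vertices are distinct, so at most one disjunct holds and disjunction agrees with
  -- addition modulo 2.
  sum4≡ : ∀ v → sum4 v₁ v₂ v₃ v₄ v ≡ terminalSum t (single v)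
  sum4≡ v with v ≟ v₁ | v ≟ v₂ | v ≟ v₃ | v ≟ v₄
  ... | yes p | yes q | _     | _     = contradiction (≡.trans (sym p) q) v₁≢v₂
  ... | yes p | _     | yes q | _     = contradiction (≡.trans (sym p) q) v₁≢v₃
  ... | yes p | _     | _     | yes q = contradiction (≡.trans (sym p) q) v₁≢v₄
  ... | _     | yes p | yes q | _     = contradiction (≡.trans (sym p) q) v₂≢v₃
  ... | _     | yes p | _     | yes q = contradiction (≡.trans (sym p) q) v₂≢v₄
  ... | _     | _     | yes p | yes q = contradiction (≡.trans (sym p) q) v₃≢v₄
  ... | yes _ | no _  | no _  | no _  = refl
  ... | no _  | yes _ | no _  | no _  = refl
  ... | no _  | no _  | yes _ | no _  = refl
  ... | no _  | no _  | no _  | yes _ = refl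
  ... | no _  | no _  | no _  | no _  = refl

  xorSum-sum4 : ∀ X → xorSum N (λ v → X v ∧ sum4 v₁ v₂ v₃ v₄ v) ≡ terminalSum t X
  xorSum-sum4 X = ≡.trans (xorSum-cong N λ v → ≡.trans (cong (X v ∧_) (sum4≡ v)) (distribute v))
    (≡.trans (xorSum-xor N _ _) (cong₂ _xor_ (xorSum-∧-single X v₁)
      (≡.trans (xorSum-xor N _ _) (cong₂ _xor_ (xorSum-∧-single X v₂)
        (≡.trans (xorSum-xor N _ _) (cong₂ _xor_ (xorSum-∧-single X v₃) (xorSum-∧-single X v₄)))))))
    where
    distribute : ∀ v → X v ∧ terminalSum t (single v) ≡
      (X v ∧ single v v₁) xor ((X v ∧ single v v₂) xor ((X v ∧ single v v₃) xor (X v ∧ single v v₄)))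
    distribute v with X v
    ... | true  = refl
    ... | false = refl

  isolated-sum : ∀ {i X} → Isolates i X → terminalSum t X ≡ true
  isolated-sum {i} (isolating at)
    rewrite at 0F | at 1F | at 2F | at 3F =
    from-yes (all? λ (i : Fin 4) → ⌊ i ≟ 0F ⌋ xor (⌊ i ≟ 1F ⌋ xor (⌊ i ≟ 2F ⌋ xor ⌊ i ≟ 3F ⌋)) ≟ᵇ true) i

  -- The cut itself serves as the deleted set. A chain avoiding it pairs to 0 with the coboundary of
  -- `X`, while its boundary pairs to 1 with `X`.
  cut-in-G : ∀ {i X} → Isolates i X → k ≤ countTrue m (cross X ∘ ends G)
  cut-in-G {X = X} I = ≮⇒≥ λ lt → let p , avoids , boundary = connected (cross X ∘ ends G) lt in
    contradiction (≡.trans (sym (isolated-sum I)) (≡.trans (sym (xorSum-sum4 X)) (≡.trans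
      (xorSum-cong N λ v → cong (X v ∧_) (≡.trans (sym (boundary v)) (bd≡xorSum (ends G) (noLoop G) p v)))
      (≡.trans (xorSum-boundary m (ends G) p X) (xorSum-false m λ e → avoided (p e) (avoids e)))))) λ ()
    where
    avoided : ∀ b {c} → (b ≡ true → c ≡ false) → b ∧ c ≡ false
    avoided true  imp = imp refl
    avoided false _   = refl

  ext : Fin (m + n) → Edge N
  ext = extendEnds G n ε

  ε-noLoop : ∀ i → proj₁ (ε i) ≢ proj₂ (ε i)
  ε-noLoop i with new-edges i
  ... | a , b , eq , a≢b , _ rewrite eq = a≢b

  ext-noLoop : ∀ e → proj₁ (ext e) ≢ proj₂ (ext e)
  ext-noLoop e with splitAt m e
  ... | inj₁ e′ = noLoop G e′
  ... | inj₂ i  = ε-noLoop i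

  new-end : ∀ {v i} → incident v (ε i) ≡ true → ¬ IsV v → OddY v
  new-end {v} {i} inc ¬isV with new-edges i
  ... | a , b , eq , _ , kinds rewrite eq with v ≟ a | v ≟ b | kinds
  ...   | yes refl | _        | inj₁ (o , _)        = o
  ...   | yes refl | _        | inj₂ (_ , inj₁ isV) = contradiction isV ¬isV
  ...   | yes refl | _        | inj₂ (_ , inj₂ o)   = o
  ...   | no _     | yes refl | inj₁ (_ , inj₁ isV) = contradiction isV ¬isV
  ...   | no _     | yes refl | inj₁ (_ , inj₂ o)   = o
  ...   | no _     | yes refl | inj₂ (o , _)        = o

  -- A vertex of Y meets exactly one new edge if its degree is odd, and none if it is even, because
  -- new edges end in Y only at odd vertices.
  new-degree : ∀ v → ¬ IsV v → xorSum n (λ i → incident v (ε i)) ≡ odd (degree G v)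
  new-degree v ¬isV with odd (degree G v) in parity-v
  ... | true with once v (¬isV , odd⇒%2≡1 (degree G v) parity-v)
  ...   | i , inc , unique = ≡.trans (xorSum-single n i λ j j≢i → ¬-not (j≢i ∘ unique j)) inc
  new-degree v ¬isV | false = xorSum-false n λ i → ¬-not λ inc →
    contradiction (≡.trans (sym parity-v) (%2≡1⇒odd (degree G v) (proj₂ (new-end inc ¬isV)))) λ ()

  even-degree : ∀ v → ¬ IsV v → xorSum (m + n) (cross (single v) ∘ ext) ≡ false
  even-degree v ¬isV = begin
    xorSum (m + n) (cross (single v) ∘ ext)              ≡⟨ xorSum-cong (m + n) (λ e → sym (incident≡cross v (ext e) (ext-noLoop e))) ⟩
    xorSum (m + n) (incident v ∘ ext)                    ≡⟨ xorSum≡odd (m + n) _ ⟩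
    odd (countTrue (m + n) (incident v ∘ ext))           ≡⟨ cong odd (countTrue-splitAt (incident v) m n (ends G) ε) ⟩
    odd (degree G v + countTrue n (incident v ∘ ε))      ≡⟨ odd-+ (degree G v) _ ⟩
    odd (degree G v) xor odd (countTrue n (incident v ∘ ε)) ≡⟨ cong (odd (degree G v) xor_) (sym (xorSum≡odd n _)) ⟩
    odd (degree G v) xor xorSum n (incident v ∘ ε)       ≡⟨ cong (odd (degree G v) xor_) (new-degree v ¬isV) ⟩
    odd (degree G v) xor odd (degree G v)                ≡⟨ xor-same (odd (degree G v)) ⟩
    false                                                ∎
    where open ≡.≡-Reasoning

  invariant : Invariant k (List.tabulate ext)
  invariant = record
    { cuts-large = λ {i} {X} I → ≤-trans (cut-in-G I) (≤-trans (m≤m+n _ _) (≤-reflexive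
        (sym (≡.trans (cutSize-tabulate X (m + n) ext) (countTrue-splitAt (cross X) m n (ends G) ε)))))
    ; parity     = λ {X} {Z} same → ≡.trans (by-degrees X) (≡.trans (xorSum-cong N (agree same)) (sym (by-degrees Z)))
    }
    where
    -- The handshake argument: Stokes for the chain of all edges, whose boundary records the degree
    -- parities.
    by-degrees : ∀ X → cutParity X (List.tabulate ext) ≡ xorSum N (λ v → X v ∧ xorSum (m + n) (cross (single v) ∘ ext))
    by-degrees X = ≡.trans (cutParity-tabulate X (m + n) ext) (sym (xorSum-boundary (m + n) ext (λ _ → true) X))

    agree : ∀ {X Z : Cut N} → (∀ j → X (t j) ≡ Z (t j)) → ∀ v →
      X v ∧ xorSum (m + n) (cross (single v) ∘ ext) ≡ Z v ∧ xorSum (m + n) (cross (single v) ∘ ext)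
    agree {X} {Z} same v with isV? v
    ... | no ¬isV rewrite even-degree v ¬isV = ≡.trans (∧-zeroʳ (X v)) (sym (∧-zeroʳ (Z v)))
    ... | yes isV with isV⇒terminal isV
    ...   | j , refl = cong (_∧ _) (same j)

  result : Σ (Fin k → Chain (m + n)) λ p →
    ((i : Fin k) → bd ext (p i) ≐ sum4 v₁ v₂ v₃ v₄) × ((i j : Fin k) → i ≢ j → NoCommonSummand (p i) (p j))
  result with invariant-packing _ ≤-refl invariant
  -- Chain `i` consists of the edges of colour `i`; its boundary is read off from the cuts
  -- `single v`, and disjointness holds because an edge has one colour.
  ... | cs , ok = (λ i e → tabulate⁻ cs e ≡ᵇ toℕ i)
    , (λ i v → ≡.trans (bd≡xorSum ext ext-noLoop _ v) (≡.trans (colourSum-tabulate (toℕ i) (single v) (m + n) ext cs)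
        (≡.trans (ok (toℕ i) (toℕ<n i) (single v)) (sym (sum4≡ v)))))
    , (λ i j i≢j e → ≡ᵇ-disjoint (tabulate⁻ cs e) (i≢j ∘ toℕ-injective))
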